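{- Let $k,\ell\ge 1$ and let $G$ and $H$ be graphs with $\delta(G)\ge k$ and $\delta(H)\ge \ell$. Then \[ \Gamma_{\times k\ell,t}(G\times H)\ge\Gamma_{\times k,t}(G)\cdot\Gamma_{\times \ell,t}(H). \]
   Context: For an integer $k\ge1$ and a graph $G$ with $\delta(G)\ge k$, a set $S\subseteq V(G)$ is a $k$-tuple total dominating set ($k$TDS) if $|N_G(x)\cap S|\ge k$ for every $x\in V(G)$, and $\Gamma_{\times k,t}(G)$ is the maximum cardinality of a minimal (with respect to inclusion) $k$TDS of $G$. The cross (direct) product $G\times H$ has vertex set $V(G)\times V(H)$, with $(g_1,h_1)\sim(g_2,h_2)$ iff $g_1g_2\in E(G)$ and $h_1h_2\in E(H)$. -}

module Defs where

open import Data.Fin using (Fin)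
open import Data.Fin.Properties using (*↔×; all?)
open import Data.Fin.Subset using (Subset; _∩_; _⊂_; ∣_∣)
open import Data.Fin.Subset.Properties using (_⊂?_; anySubset?)
open import Data.List using (List; allFin; filter; map; upTo)
open import Data.List.Extrema.Nat using (max; min)
open import Data.Nat using (ℕ; suc; _*_; _≤_; _≟_; _≤?_)
open import Data.Product using (_×_; _,_)
open import Data.Product.Function.NonDependent.Propositional using (_×-↔_)
open import Data.Vec using (tabulate)
open import Function using (_∘_; _↔_; Inverse)
open import Function.Properties.Inverse using (↔-sym; ↔-trans)
open import Level using (0ℓ)
open import Relation.Binary using (Rel; Decidable; Symmetric)
open import Relation.Binary.PropositionalEquality using (subst)
open import Relation.Nullary using (Dec; ¬_; does)
open import Relation.Nullary.Decidable using (map′; ¬?; _×-dec_)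

record Graph : Set₁ where
  infix 4 _~_ _~?_
  field
    V       : Set
    order   : ℕ
    enum    : V ↔ Fin order
    _~_     : Rel V 0ℓ
    _~?_    : Decidable _~_
    ~-sym   : Symmetric _~_
    ~-irr   : ∀ {x} → ¬ (x ~ x)

  open Inverse enum public using () renaming
    (to to index; from to vertex; strictlyInverseʳ to vertex-index)

  -- A set of vertices is represented by the set of its indices under enum.
  VertexSet : Set
  VertexSet = Subset order

  N : V → VertexSet
  N x = tabulate λ i → does (x ~? vertex i)

  deg : V → ℕ
  deg x = ∣ N x ∣

open Graph using (V; VertexSet)

-- The first argument of min is a default. Degrees never exceed the order, so
-- it affects the value only for the graph without vertices, where δ is 0.
δ : Graph → ℕ
δ G = min order (map (deg ∘ vertex) (allFin order))
  where open Graph G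

module _ (k : ℕ) (G : Graph) where
  open Graph G hiding (V; VertexSet)

  IsTDS : VertexSet G → Set
  IsTDS S = ∀ (x : V G) → k ≤ ∣ N x ∩ S ∣

  IsMinimalTDS : VertexSet G → Set
  IsMinimalTDS S = IsTDS S × (∀ T → T ⊂ S → ¬ IsTDS T)

  isTDS? : ∀ S → Dec (IsTDS S)
  isTDS? S = map′
    (λ h x → subst (λ y → k ≤ ∣ N y ∩ S ∣) (vertex-index x) (h (index x)))
    (λ h i → h (vertex i))
    (all? λ i → k ≤? ∣ N (vertex i) ∩ S ∣)

  isMinimalTDS? : ∀ S → Dec (IsMinimalTDS S)
  isMinimalTDS? S = isTDS? S ×-dec map′
    (λ h T T⊂S tds → h (T , T⊂S , tds))
    (λ h (T , T⊂S , tds) → h T T⊂S tds)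
    (¬? (anySubset? λ T → (T ⊂? S) ×-dec isTDS? T))

  minimalTDSSizes : List ℕ
  minimalTDSSizes = filter
    (λ m → anySubset? λ S → isMinimalTDS? S ×-dec (∣ S ∣ ≟ m))
    (upTo (suc order))

  -- Γ_{×k,t}(G). The list is nonempty whenever δ(G) ≥ k, since then all of
  -- V(G) is a k-tuple total dominating set; the default 0 is harmless as
  -- sizes are natural numbers.
  Γ : ℕ
  Γ = max 0 minimalTDSSizes

infixl 7 _⊗_

_⊗_ : Graph → Graph → Graph
G ⊗ H = record
  { V     = V G × V H
  ; order = G.order * H.order
  ; enum  = ↔-trans (G.enum ×-↔ H.enum) (↔-sym *↔×)
  ; _~_   = λ (g₁ , h₁) (g₂ , h₂) → g₁ G.~ g₂ × h₁ H.~ h₂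
  ; _~?_  = λ (g₁ , h₁) (g₂ , h₂) → (g₁ G.~? g₂) ×-dec (h₁ H.~? h₂)
  ; ~-sym = λ (p , q) → G.~-sym p , H.~-sym q
  ; ~-irr = λ (p , _) → G.~-irr p
  }
  where
  module G = Graph G
  module H = Graph H

{-# OPTIONS --safe #-}

-- If S and T are minimal, then so is S × T: the neighbourhood of (x , y) meets
-- it in |N x ∩ S| · |N y ∩ T| vertices. By minimality, each s ∈ S lies in the
-- neighbourhood of some x with |N x ∩ S| = k, and likewise each t ∈ T in that
-- of some y with |N y ∩ T| = ℓ. So (s , t) lies in the neighbourhood of
-- (x , y), which meets S × T in exactly kℓ vertices; hence (s , t) cannot be
-- dropped.
module Submission where

open import Defs
open import Algebra.Bundles using (CommutativeMonoid)
open import Algebra.Properties.CommutativeSemigroup using (interchange)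
open import Data.Bool using (true; _∧_)
open import Data.Bool.Properties using (∧-commutativeMonoid)
open import Data.Fin using (Fin; zero; suc; combine)
open import Data.Fin.Properties using (¬∀⟶∃¬; remQuot-combine; combine-surjective)
open import Data.Fin.Subset using (Subset; inside; outside; ⁅_⁆; _∈_; _∩_; _─_; _-_; _⊂_; ∣_∣)
open import Data.Fin.Subset.Properties
  using (_∈?_; anySubset?; ∣p∣≤n; p⊆q⇒∣p∣≤∣q∣; p⊂q⇒∣p∣<∣q∣; p─⊥≡p; x∈p∩q⁺; x∈p∩q⁻;
         x∈p⇒p-x⊂p; x∈p∧x≢y⇒x∈p-y)
open import Data.List using (upTo)
open import Data.List.Extrema.Nat using (xs≤max; argmax-sel)
open import Data.List.Membership.Propositional.Properties
  using (∈-filter⁺; ∈-filter⁻; ∈-upTo⁺)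
import Data.List.Relation.Unary.All as All
open import Data.Nat using (ℕ; suc; _+_; _*_; _≤_; _<_; _≥_; z≤n; s≤s; _≟_; _≤?_)
open import Data.Nat.Properties
  using (≤-reflexive; ≤-trans; <-≤-trans; <⇒≱; ≰⇒>; n≤1+n;
         *-mono-≤; *-zeroʳ; module ≤-Reasoning)
open import Data.Product using (_×_; _,_; proj₁; proj₂; ∃; ∃-syntax)
open import Data.Sum using (_⊎_; inj₁; inj₂)
open import Data.Vec using ([]; _∷_; _++_; map; lookup; _⊛*_)
open import Data.Vec.Properties
  using (lookup-⊛*; lookup-map; lookup-zipWith; lookup∘tabulate; []=⇒lookup; lookup⇒[]=;
         map-id)
open import Data.Vec.Relation.Binary.Pointwise.Extensional using (ext; Pointwise-≡⇒≡)
open import Function using (_∘_)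
open import Relation.Binary.PropositionalEquality
  using (_≡_; refl; sym; trans; cong; cong₂; subst; module ≡-Reasoning)
open import Relation.Nullary using (Dec; ¬_; does; yes; no; contradiction)
open import Relation.Nullary.Decidable using (_×-dec_)

private
  variable
    m n : ℕ

infixr 8 _⊠_

-- The Cartesian product of two sets of indices, with the pair of `i` and `j` at position
-- `combine i j`, as in the enumeration of `G ⊗ H`. Each entry of `p` contributes a block that is
-- `q` or empty, so cardinalities follow by induction on `p`.
_⊠_ : Subset m → Subset n → Subset (m * n)
p ⊠ q = map _∧_ p ⊛* q

∣p++q∣≡∣p∣+∣q∣ : ∀ (p : Subset m) (q : Subset n) → ∣ p ++ q ∣ ≡ ∣ p ∣ + ∣ q ∣
∣p++q∣≡∣p∣+∣q∣ []            q = refl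
∣p++q∣≡∣p∣+∣q∣ (inside  ∷ p) q = cong suc (∣p++q∣≡∣p∣+∣q∣ p q)
∣p++q∣≡∣p∣+∣q∣ (outside ∷ p) q = ∣p++q∣≡∣p∣+∣q∣ p q

∣outside∧p∣≡0 : ∀ (p : Subset n) → ∣ map (outside ∧_) p ∣ ≡ 0
∣outside∧p∣≡0 []      = refl
∣outside∧p∣≡0 (_ ∷ p) = ∣outside∧p∣≡0 p

∣p⊠q∣≡∣p∣*∣q∣ : ∀ (p : Subset m) (q : Subset n) → ∣ p ⊠ q ∣ ≡ ∣ p ∣ * ∣ q ∣
∣p⊠q∣≡∣p∣*∣q∣ []      q = refl
∣p⊠q∣≡∣p∣*∣q∣ (inside ∷ p) q = trans (∣p++q∣≡∣p∣+∣q∣ (map (inside ∧_) q) (p ⊠ q))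
  (cong₂ _+_ (cong ∣_∣ (map-id q)) (∣p⊠q∣≡∣p∣*∣q∣ p q))
∣p⊠q∣≡∣p∣*∣q∣ (outside ∷ p) q = trans (∣p++q∣≡∣p∣+∣q∣ (map (outside ∧_) q) (p ⊠ q))
  (cong₂ _+_ (∣outside∧p∣≡0 q) (∣p⊠q∣≡∣p∣*∣q∣ p q))

lookup-⊠ : ∀ (p : Subset m) (q : Subset n) i j →
           lookup (p ⊠ q) (combine i j) ≡ lookup p i ∧ lookup q j
lookup-⊠ p q i j = trans (lookup-⊛* (map _∧_ p) q i j)
  (cong (λ f → f (lookup q j)) (lookup-map i _∧_ p))

⊠-unique : ∀ {r : Subset (m * n)} (p : Subset m) (q : Subset n) →
      (∀ i j → lookup r (combine i j) ≡ lookup p i ∧ lookup q j) → r ≡ p ⊠ q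
⊠-unique {m = m} {n = n} {r = r} p q eq = Pointwise-≡⇒≡ (ext λ c → helper c (combine-surjective {m} {n} c))
  where
  -- With the surjectivity witness as an argument, matching on `refl` replaces `c` by `combine i j`.
  helper : ∀ c → (∃[ i ] ∃[ j ] combine {m} {n} i j ≡ c) → lookup r c ≡ lookup (p ⊠ q) c
  helper _ (i , j , refl) = trans (eq i j) (sym (lookup-⊠ p q i j))

∩-⊠-interchange : ∀ (p p′ : Subset m) (q q′ : Subset n) →
                  (p ⊠ q) ∩ (p′ ⊠ q′) ≡ (p ∩ p′) ⊠ (q ∩ q′)
∩-⊠-interchange p p′ q q′ = ⊠-unique (p ∩ p′) (q ∩ q′) λ i j → begin
  lookup ((p ⊠ q) ∩ (p′ ⊠ q′)) (combine i j)
    ≡⟨ lookup-zipWith _∧_ (combine i j) (p ⊠ q) (p′ ⊠ q′) ⟩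
  lookup (p ⊠ q) (combine i j) ∧ lookup (p′ ⊠ q′) (combine i j)
    ≡⟨ cong₂ _∧_ (lookup-⊠ p q i j) (lookup-⊠ p′ q′ i j) ⟩
  (lookup p i ∧ lookup q j) ∧ (lookup p′ i ∧ lookup q′ j)
    ≡⟨ interchange (CommutativeMonoid.commutativeSemigroup ∧-commutativeMonoid)
         (lookup p i) (lookup q j) (lookup p′ i) (lookup q′ j) ⟩
  (lookup p i ∧ lookup p′ i) ∧ (lookup q j ∧ lookup q′ j)
    ≡⟨ cong₂ _∧_ (lookup-zipWith _∧_ i p p′) (lookup-zipWith _∧_ j q q′) ⟨
  lookup (p ∩ p′) i ∧ lookup (q ∩ q′) j ∎
  where open ≡-Reasoning

∈-⊠⁺ : ∀ {p : Subset m} {q : Subset n} {i j} → i ∈ p → j ∈ q → combine i j ∈ p ⊠ q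
∈-⊠⁺ {p = p} {q} {i} {j} i∈p j∈q = lookup⇒[]= (combine i j) (p ⊠ q)
  (trans (lookup-⊠ p q i j) (cong₂ _∧_ ([]=⇒lookup i∈p) ([]=⇒lookup j∈q)))

∈-⊠⁻ : ∀ (p : Subset m) (q : Subset n) i j → combine i j ∈ p ⊠ q → i ∈ p × j ∈ q
∈-⊠⁻ p q i j ij∈ with lookup p i in eqᵢ | lookup q j in eqⱼ
                    | trans (sym (lookup-⊠ p q i j)) ([]=⇒lookup ij∈)
-- For any other pair of Booleans the third scrutinee would prove `false ≡ true`.
... | true | true | _ = lookup⇒[]= i p eqᵢ , lookup⇒[]= j q eqⱼ

-- For `r = ⁅ s ⁆`, this turns deleting `s` from a dominating set into deleting it from the part of
-- that set inside a neighbourhood.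
p∩[q─r]≡p∩q─r : ∀ (p q r : Subset n) → p ∩ (q ─ r) ≡ p ∩ q ─ r
p∩[q─r]≡p∩q─r []            []      []            = refl
p∩[q─r]≡p∩q─r (x       ∷ p) (y ∷ q) (outside ∷ r) = cong (x ∧ y ∷_) (p∩[q─r]≡p∩q─r p q r)
p∩[q─r]≡p∩q─r (inside  ∷ p) (y ∷ q) (inside  ∷ r) = cong (outside ∷_) (p∩[q─r]≡p∩q─r p q r)
p∩[q─r]≡p∩q─r (outside ∷ p) (y ∷ q) (inside  ∷ r) = cong (outside ∷_) (p∩[q─r]≡p∩q─r p q r)

∣p∣≤1+∣p-x∣ : ∀ (p : Subset n) x → ∣ p ∣ ≤ suc ∣ p - x ∣
∣p∣≤1+∣p-x∣ (inside  ∷ p) zero    = s≤s (≤-reflexive (cong ∣_∣ (sym (p─⊥≡p p))))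
∣p∣≤1+∣p-x∣ (outside ∷ p) zero    =
  ≤-trans (≤-reflexive (cong ∣_∣ (sym (p─⊥≡p p)))) (n≤1+n _)
∣p∣≤1+∣p-x∣ (inside  ∷ p) (suc x) = s≤s (∣p∣≤1+∣p-x∣ p x)
∣p∣≤1+∣p-x∣ (outside ∷ p) (suc x) = ∣p∣≤1+∣p-x∣ p x

-- Were `x` outside `p`, every element of `p` would survive the removal.
∣p-x∣<∣p∣⇒x∈p : ∀ (p : Subset n) x → ∣ p - x ∣ < ∣ p ∣ → x ∈ p
∣p-x∣<∣p∣⇒x∈p p x lt with x ∈? p
... | yes x∈p = x∈p
... | no  x∉p = contradiction
  (p⊆q⇒∣p∣≤∣q∣ {p = p} {q = p - x} λ y∈p → x∈p∧x≢y⇒x∈p-y y∈p λ { refl → x∉p y∈p }) (<⇒≱ lt)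

module _ (k : ℕ) (G : Graph) where
  open Graph G

  -- The neighbourhood of x is tight for S and prevents the removal of s.
  Critical : VertexSet → Fin order → V → Set
  Critical S s x = s ∈ N x × ∣ N x ∩ S ∣ ≤ k

  ¬IsTDS⇒∃ : ∀ {S} → ¬ IsTDS k G S → ∃[ x ] ∣ N x ∩ S ∣ < k
  ¬IsTDS⇒∃ {S} ¬tds
    with i , k≰ ← ¬∀⟶∃¬ order _ (λ i → k ≤? ∣ N (vertex i) ∩ S ∣)
           (λ h → ¬tds (λ x → subst (λ y → k ≤ ∣ N y ∩ S ∣) (vertex-index x) (h (index x))))
    = vertex i , ≰⇒> k≰

  -- Some `x` has fewer than `k` neighbours in `S - s` but at least `k` in `S`, so `s` is one of
  -- them. Only one neighbour is lost, so `x` had at most `k`.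
  minimal⇒critical : ∀ {S} → IsMinimalTDS k G S → ∀ {s} → s ∈ S → ∃ (Critical S s)
  minimal⇒critical {S} (tds , min) {s} s∈S
    with x , lt ← ¬IsTDS⇒∃ (min (S - s) (x∈p⇒p-x⊂p s∈S))
    rewrite p∩[q─r]≡p∩q─r (N x) S ⁅ s ⁆
    = x , proj₁ (x∈p∩q⁻ (N x) S (∣p-x∣<∣p∣⇒x∈p (N x ∩ S) s (<-≤-trans lt (tds x))))
    , ≤-trans (∣p∣≤1+∣p-x∣ (N x ∩ S) s) lt

  -- A proper subset `T` misses some `s` in `S`. At a vertex critical for `s`, the neighbours in `T`
  -- form a proper subset of at most `k` vertices.
  critical⇒minimal : ∀ {S} → IsTDS k G S → (∀ {s} → s ∈ S → ∃ (Critical S s)) →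
                     IsMinimalTDS k G S
  critical⇒minimal {S} tds crit = tds , λ { T (T⊆S , s , s∈S , s∉T) tdsT →
    let x , s∈Nx , tight = crit s∈S
        NT⊂NS : N x ∩ T ⊂ N x ∩ S
        NT⊂NS = (λ y∈ → let y∈N , y∈T = x∈p∩q⁻ (N x) T y∈ in x∈p∩q⁺ (y∈N , T⊆S y∈T))
              , s , x∈p∩q⁺ (s∈Nx , s∈S) , s∉T ∘ proj₂ ∘ x∈p∩q⁻ (N x) T
    in <⇒≱ (<-≤-trans (p⊂q⇒∣p∣<∣q∣ NT⊂NS) tight) (tdsT x) }

  -- The decision procedure by which `minimalTDSSizes` filters, named so that the filter lemmas can
  -- refer to it.
  hasMinimalTDS? : ∀ m → Dec (∃[ S ] IsMinimalTDS k G S × ∣ S ∣ ≡ m)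
  hasMinimalTDS? m = anySubset? λ S → isMinimalTDS? k G S ×-dec (∣ S ∣ ≟ m)

  ∣minimal∣≤Γ : ∀ {S} → IsMinimalTDS k G S → ∣ S ∣ ≤ Γ k G
  ∣minimal∣≤Γ {S} min = All.lookup (xs≤max 0 (minimalTDSSizes k G))
    -- The range `upTo (suc order)` includes `order` itself, so no size is missed.
    (∈-filter⁺ hasMinimalTDS? (∈-upTo⁺ (s≤s (∣p∣≤n S))) (S , min , refl))

  -- A maximum is either its default, here 0, or an entry of the list.
  Γ-attained : Γ k G ≡ 0 ⊎ ∃[ S ] IsMinimalTDS k G S × ∣ S ∣ ≡ Γ k G
  Γ-attained with argmax-sel (λ m → m) 0 (minimalTDSSizes k G)
  ... | inj₁ Γ≡0 = inj₁ Γ≡0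
  ... | inj₂ Γ∈  = inj₂ (proj₂ (∈-filter⁻ hasMinimalTDS? {xs = upTo (suc order)} Γ∈))

module _ (G H : Graph) where
  private
    module G = Graph G
    module H = Graph H
    module P = Graph (G ⊗ H)

  N-⊗ : ∀ x y → P.N (x , y) ≡ G.N x ⊠ H.N y
  N-⊗ x y = ⊠-unique (G.N x) (H.N y) λ i j → begin
    lookup (P.N (x , y)) (combine i j)
      ≡⟨ lookup∘tabulate _ (combine i j) ⟩
    does ((x , y) P.~? P.vertex (combine i j))
      -- `P.vertex` decodes an index by `remQuot`, the inverse of `combine`; adjacency in the
      -- product is a conjunction.
      ≡⟨ cong (λ (a , b) → does (x G.~? G.vertex a) ∧ does (y H.~? H.vertex b))
              (remQuot-combine i j) ⟩
    does (x G.~? G.vertex i) ∧ does (y H.~? H.vertex j)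
      ≡⟨ cong₂ _∧_ (lookup∘tabulate _ i) (lookup∘tabulate _ j) ⟨
    lookup (G.N x) i ∧ lookup (H.N y) j ∎
    where open ≡-Reasoning

  ∣N-⊗∩⊠∣ : ∀ x y S T →
    ∣ P.N (x , y) ∩ (S ⊠ T) ∣ ≡ ∣ G.N x ∩ S ∣ * ∣ H.N y ∩ T ∣
  ∣N-⊗∩⊠∣ x y S T = begin
    ∣ P.N (x , y) ∩ (S ⊠ T) ∣          ≡⟨ cong (λ p → ∣ p ∩ (S ⊠ T) ∣) (N-⊗ x y) ⟩
    ∣ (G.N x ⊠ H.N y) ∩ (S ⊠ T) ∣      ≡⟨ cong ∣_∣ (∩-⊠-interchange (G.N x) S (H.N y) T) ⟩
    ∣ (G.N x ∩ S) ⊠ (H.N y ∩ T) ∣      ≡⟨ ∣p⊠q∣≡∣p∣*∣q∣ (G.N x ∩ S) (H.N y ∩ T) ⟩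
    ∣ G.N x ∩ S ∣ * ∣ H.N y ∩ T ∣      ∎
    where open ≡-Reasoning

  ⊠-minimal : ∀ {k ℓ S T} → IsMinimalTDS k G S → IsMinimalTDS ℓ H T →
              IsMinimalTDS (k * ℓ) (G ⊗ H) (S ⊠ T)
  ⊠-minimal {k} {ℓ} {S} {T} minS@(tdsS , _) minT@(tdsT , _) =
    critical⇒minimal (k * ℓ) (G ⊗ H)
      (λ (x , y) → ≤-trans (*-mono-≤ (tdsS x) (tdsT y)) (≤-reflexive (sym (∣N-⊗∩⊠∣ x y S T))))
      (λ {c} → critical c (combine-surjective {G.order} {H.order} c))
    where
    critical : ∀ c → (∃[ i ] ∃[ j ] combine {G.order} {H.order} i j ≡ c) → c ∈ S ⊠ T →
               ∃ (Critical (k * ℓ) (G ⊗ H) (S ⊠ T) c)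
    critical _ (i , j , refl) ij∈
      with i∈S , j∈T ← ∈-⊠⁻ S T i j ij∈
      with x , i∈Nx , tightˣ ← minimal⇒critical k G minS i∈S
         | y , j∈Ny , tightʸ ← minimal⇒critical ℓ H minT j∈T
      = (x , y)
      , subst (combine i j ∈_) (sym (N-⊗ x y)) (∈-⊠⁺ i∈Nx j∈Ny)
      , ≤-trans (≤-reflexive (∣N-⊗∩⊠∣ x y S T)) (*-mono-≤ tightˣ tightʸ)

mainTheorem13 : ∀ (k ℓ : ℕ) → k ≥ 1 → ℓ ≥ 1 →
    ∀ (G H : Graph) → δ G ≥ k → δ H ≥ ℓ →
    Γ (k * ℓ) (G ⊗ H) ≥ Γ k G * Γ ℓ H
mainTheorem13 k ℓ _ _ G H _ _ with Γ-attained k G | Γ-attained ℓ H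
-- If either factor is 0, so is the product, and the bound is trivial.
... | inj₁ Γ≡0 | _ rewrite Γ≡0 = z≤n
... | inj₂ _ | inj₁ Γ≡0 rewrite Γ≡0 | *-zeroʳ (Γ k G) = z≤n
... | inj₂ (S , minS , ∣S∣≡Γ) | inj₂ (T , minT , ∣T∣≡Γ) = begin
  Γ k G * Γ ℓ H      ≡⟨ cong₂ _*_ ∣S∣≡Γ ∣T∣≡Γ ⟨
  ∣ S ∣ * ∣ T ∣      ≡⟨ ∣p⊠q∣≡∣p∣*∣q∣ S T ⟨
  ∣ S ⊠ T ∣          ≤⟨ ∣minimal∣≤Γ (k * ℓ) (G ⊗ H) (⊠-minimal G H minS minT) ⟩
  Γ (k * ℓ) (G ⊗ H)  ∎
  where open ≤-Reasoning
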